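{- For all integers $m,n\geq 1$, \[p^{od}_{ed}(m,n)-p^{od}_{ed}(m,n-1)=D_o(m,n)-D_e(m,n-1).\]
   Context: $\mathcal{P}^{od}_{ed}$ is the set of integer partitions whose parts are all distinct and such that every even part is smaller than every odd part. Partitions consisting only of odd parts, or only of even parts, are allowed. For integers $m\ge 1$, $n\ge 0$: - $p^{od}_{ed}(m,n)$ is the number of partitions of $n$ in $\mathcal{P}^{od}_{ed}$ with exactly $m$ parts; in particular $p^{od}_{ed}(m,0)=0$. - $D_o(m,n)$ is the number of partitions of $n$ into exactly $m$ distinct odd parts. - $D_e(m,n)$ is the number of partitions of $n$ into exactly $m$ distinct even parts. -}

module Defs where

open import Data.List.Base using (List; []; _∷_; length; filter; applyUpTo; cartesianProductWith)
open import Data.List.Membership.Propositional using (_∈_)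
open import Data.List.Membership.Propositional.Properties
  using (∈-filter⁺; ∈-filter⁻; ∈-cartesianProductWith⁺; ∈-applyUpTo⁺)
open import Data.List.Properties using (∷-injective)
open import Data.List.Relation.Unary.All as All using (All; []; _∷_)
open import Data.List.Relation.Unary.Any using (here)
open import Data.List.Relation.Unary.AllPairs using ([]; _∷_)
open import Data.List.Relation.Unary.Linked using (Linked; linked?)
open import Data.List.Relation.Unary.Unique.Propositional using (Unique)
open import Data.List.Relation.Unary.Unique.DecPropositional using (unique?)
import Data.List.Relation.Unary.Unique.Propositional.Properties as Unique
open import Data.Nat.Base using (ℕ; zero; suc; _≤_; _<_; _≥_; s≤s)
open import Data.Nat.Divisibility using (_∣_; _∣?_)
open import Data.Nat.ListAction using (sum)
open import Data.Nat.Properties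
  using (_≟_; _≤?_; _<?_; _≥?_; <⇒≢; suc-injective; ≤-trans; m≤m+n; m≤n+m)
open import Data.Product using (_×_; _,_; proj₂)
open import Function.Base using (_∘_)
open import Function.Bundles using (_⇔_; mk⇔)
open import Relation.Binary.PropositionalEquality using (_≡_; refl)
open import Relation.Nullary using (¬_; ¬?; _×-dec_; _→-dec_)
open import Relation.Nullary.Decidable using (map′)
open import Relation.Unary using (Decidable)

Even : ℕ → Set
Even x = 2 ∣ x

Odd : ℕ → Set
Odd x = ¬ Even x

even? : Decidable Even
even? = 2 ∣?_

odd? : Decidable Odd
odd? = ¬? ∘ even?

record IsPartition (m n : ℕ) (λs : List ℕ) : Set where
  constructor mkPartition
  field
    nonincreasing : Linked _≥_ λs
    positive      : All (1 ≤_) λs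
    parts         : length λs ≡ m
    size          : sum λs ≡ n

isPartition? : ∀ m n → Decidable (IsPartition m n)
isPartition? m n λs = map′
  (λ (a , b , c , d) → mkPartition a b c d)
  (λ (mkPartition a b c d) → a , b , c , d)
  (linked? _≥?_ λs ×-dec All.all? (1 ≤?_) λs ×-dec length λs ≟ m ×-dec sum λs ≟ n)

words : ∀ {A : Set} → ℕ → List A → List (List A)
words zero    as = [] ∷ []
words (suc m) as = cartesianProductWith _∷_ as (words m as)

-- The partitions of n into exactly m parts.  No part exceeds n, so it is enough
-- to search the words of length m over {1,…,n}; ∈-partitions and
-- partitions-unique show that each partition is listed exactly once.
partitions : ℕ → ℕ → List (List ℕ)
partitions m n = filter (isPartition? m n) (words m (applyUpTo suc n))

count : {P : List ℕ → Set} → Decidable P → ℕ → ℕ → ℕ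
count P? m n = length (filter P? (partitions m n))

EvensBelowOdds : List ℕ → Set
EvensBelowOdds λs = All (λ x → All (λ y → Even x → Odd y → x < y) λs) λs

evensBelowOdds? : Decidable EvensBelowOdds
evensBelowOdds? λs =
  All.all? (λ x → All.all? (λ y → even? x →-dec odd? y →-dec x <? y) λs) λs

-- 𝒫ᵒᵈₑ and pᵒᵈₑ stand for 𝒫^{od}_{ed} and p^{od}_{ed} (Unicode has no subscript d).
𝒫ᵒᵈₑ : List ℕ → Set
𝒫ᵒᵈₑ λs = Unique λs × EvensBelowOdds λs

𝒫ᵒᵈₑ? : Decidable 𝒫ᵒᵈₑ
𝒫ᵒᵈₑ? λs = unique? _≟_ λs ×-dec evensBelowOdds? λs

pᵒᵈₑ : ℕ → ℕ → ℕ
pᵒᵈₑ = count 𝒫ᵒᵈₑ?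

DistinctOdd : List ℕ → Set
DistinctOdd λs = Unique λs × All Odd λs

DistinctEven : List ℕ → Set
DistinctEven λs = Unique λs × All Even λs

distinctOdd? : Decidable DistinctOdd
distinctOdd? λs = unique? _≟_ λs ×-dec All.all? odd? λs

distinctEven? : Decidable DistinctEven
distinctEven? λs = unique? _≟_ λs ×-dec All.all? even? λs

Dₒ : ℕ → ℕ → ℕ
Dₒ = count distinctOdd?

Dₑ : ℕ → ℕ → ℕ
Dₑ = count distinctEven?

private
  ∈-words : ∀ {A : Set} {as xs : List A} → All (_∈ as) xs → xs ∈ words (length xs) as
  ∈-words []         = here refl
  ∈-words (x∈ ∷ xs∈) = ∈-cartesianProductWith⁺ _∷_ x∈ (∈-words xs∈)

  words-unique : ∀ {A : Set} m {as : List A} → Unique as → Unique (words m as)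
  words-unique zero    u = [] ∷ []
  words-unique (suc m) u = Unique.cartesianProductWith⁺ _∷_ ∷-injective u (words-unique m u)

  all≤sum : ∀ xs → All (_≤ sum xs) xs
  all≤sum []       = []
  all≤sum (x ∷ xs) =
    m≤m+n x (sum xs) ∷ All.map (λ y≤ → ≤-trans y≤ (m≤n+m (sum xs) x)) (all≤sum xs)

  ∈-1⋯ : ∀ {n x} → 1 ≤ x → x ≤ n → x ∈ applyUpTo suc n
  ∈-1⋯ (s≤s _) x≤n = ∈-applyUpTo⁺ suc x≤n

∈-partitions : ∀ m n λs → λs ∈ partitions m n ⇔ IsPartition m n λs
∈-partitions m n λs = mk⇔
  (λ λs∈ → proj₂ (∈-filter⁻ (isPartition? m n) {xs = words m (applyUpTo suc n)} λs∈))
  (λ { p@(mkPartition _ pos refl refl) →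
       ∈-filter⁺ (isPartition? m n)
         (∈-words (All.zipWith (λ (a , b) → ∈-1⋯ a b) (pos , all≤sum λs))) p })

partitions-unique : ∀ m n → Unique (partitions m n)
partitions-unique m n = Unique.filter⁺ (isPartition? m n) (words-unique m
  (Unique.applyUpTo⁺₁ suc n (λ i<j _ → <⇒≢ i<j ∘ suc-injective)))

{-# OPTIONS --safe #-}
-- Decrementing the largest even part turns a partition of n in 𝒫ᵒᵈₑ that is not
-- all odd into a partition of n − 1 in 𝒫ᵒᵈₑ that is not all even, with the same
-- number of parts; incrementing the smallest odd part is the inverse.  The moved
-- part stays strictly between its neighbours because parts of equal parity differ
-- by at least 2.
module Submission where

open import Defs
open import Data.Nat.Base using (ℕ; _≥_; _∸_)
open import Data.Integer.Base using (+_; _-_)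
open import Relation.Binary.PropositionalEquality using (_≡_)

open import Data.Integer.Base using (_⊖_)
open import Data.Integer.Properties using ([+m]-[+n]≡m⊖n; +-cancelˡ-⊖)
open import Data.List.Base using (List; []; _∷_; length; filter; map)
open import Data.List.Membership.Propositional using (_∈_)
open import Data.List.Membership.Propositional.Properties
  using (∈-filter⁺; ∈-filter⁻; ∈-map⁺; ∈-map⁻)
open import Data.List.Membership.Propositional.Properties.WithK using (unique∧set⇒bag)
open import Data.List.Properties using (length-map; map-∘; map-id-local; filter-≐)
open import Data.List.Relation.Binary.BagAndSetEquality using (∼bag⇒↭)
open import Data.List.Relation.Binary.Permutation.Propositional.Properties using (↭-length)
open import Data.List.Relation.Unary.All as All using (All; []; _∷_; all?)
open import Data.List.Relation.Unary.AllPairs as AllPairs using (AllPairs; []; _∷_)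
open import Data.List.Relation.Unary.Linked.Properties using (Linked⇒AllPairs; AllPairs⇒Linked)
open import Data.List.Relation.Unary.Unique.Propositional using (Unique)
import Data.List.Relation.Unary.Unique.Propositional.Properties as Unique
open import Data.Nat.Base using (zero; suc; pred; _+_; _≤_; _>_; s≤s; z≤n)
open import Data.Nat.Divisibility using (_∣0; ∣1⇒≡1; ∣m+n∣m⇒∣n; ∣m∣n⇒∣m+n; ∣-refl)
open import Data.Nat.ListAction using (sum)
open import Data.Nat.Properties
  using (+-suc; +-comm; ≤-trans; <⇒≤; <⇒≢; ≤∧≢⇒<; m≤n⇒m≤1+n; <-asym; suc-injective; n≢0⇒n>0)
open import Data.Product using (_×_; _,_; proj₁; proj₂)
open import Function.Base using (_∘_)
open import Function.Bundles using (mk⇔; Equivalence)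
open import Level using (Level)
open import Relation.Binary.PropositionalEquality
  using (refl; sym; trans; cong; cong₂; subst; _≢_; module ≡-Reasoning)
open import Relation.Nullary using (¬_; yes; no; contradiction)
open import Relation.Nullary.Decidable using (decidable-stable)
open import Relation.Unary using (Pred; Decidable; _∩_; ∁; _≐_)
open import Relation.Unary.Properties using (_∩?_; ∁?)

private variable
  a p q : Level
  A B : Set a

-- Counting by bijections and by cases.

-- Duplicate-free lists with the same members are permutations of each other, and `map f xs` and
-- `ys` are such a pair. The inverse laws are asked only on the two lists, because `lower` and
-- `raise` are not inverse on arbitrary lists.
bijection⇒length≡ : (f : A → B) (g : B → A) {xs : List A} {ys : List B} →
  Unique xs → Unique ys →
  (∀ {x} → x ∈ xs → f x ∈ ys × g (f x) ≡ x) →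
  (∀ {y} → y ∈ ys → g y ∈ xs × f (g y) ≡ y) →
  length xs ≡ length ys
bijection⇒length≡ f g {xs} {ys} xs! ys! to from =
  trans (sym (length-map f xs))
    (↭-length (∼bag⇒↭ (unique∧set⇒bag map! ys! (mk⇔ to∈ from∈))))
  where
  gf≡id : map g (map f xs) ≡ xs
  gf≡id = trans (sym (map-∘ xs)) (map-id-local (All.tabulate (proj₂ ∘ to)))

  map! : Unique (map f xs)
  -- `map g` sends this list back to `xs`, so a repetition in it would give one in `xs`.
  map! = Unique.map⁻ (subst Unique (sym gf≡id) xs!)

  to∈ : ∀ {y} → y ∈ map f xs → y ∈ ys
  to∈ y∈ with ∈-map⁻ f y∈
  ... | _ , x∈ , refl = proj₁ (to x∈)

  from∈ : ∀ {y} → y ∈ ys → y ∈ map f xs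
  from∈ y∈ = subst (_∈ map f xs) (proj₂ (from y∈)) (∈-map⁺ f (proj₁ (from y∈)))

length-filter-split : {P : Pred A p} {Q : Pred A q} (P? : Decidable P) (Q? : Decidable Q) → ∀ xs →
  length (filter P? xs) ≡ length (filter (P? ∩? Q?) xs) + length (filter (P? ∩? ∁? Q?) xs)
length-filter-split P? Q? [] = refl
length-filter-split P? Q? (x ∷ xs) with ih ← length-filter-split P? Q? xs | P? x | Q? x
... | no  _ | _     = ih
... | yes _ | yes _ = cong suc ih
... | yes _ | no  _ = trans (cong suc ih) (sym (+-suc _ _))

even⇒odd-suc : ∀ {x} → Even x → Odd (suc x)
even⇒odd-suc {x} ex esx
  with () ← ∣1⇒≡1 (∣m+n∣m⇒∣n (subst Even (sym (+-comm x 1)) esx) ex)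

odd⇒even-suc : ∀ {x} → Odd x → Even (suc x)
odd⇒even-suc {zero}        ox = contradiction (2 ∣0) ox
odd⇒even-suc {suc zero}    ox = ∣-refl
odd⇒even-suc {suc (suc x)} ox = ∣m∣n⇒∣m+n ∣-refl (odd⇒even-suc (ox ∘ ∣m∣n⇒∣m+n ∣-refl))

even-suc⇒odd : ∀ {x} → Even (suc x) → Odd x
even-suc⇒odd esx ex = even⇒odd-suc ex esx

odd≢even : ∀ {x y} → Odd x → Even y → y ≢ x
odd≢even ox ey refl = ox ey

-- Partitions in `𝒫ᵒᵈₑ` as chains.

-- On a strictly decreasing list, `EvensBelowOdds` says that only even parts follow an even part.
-- Required of all pairs, `_≻_` merges order, distinctness and this parity condition into one
-- property that passes to tails.
_≻_ : ℕ → ℕ → Set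
x ≻ y = x > y × (Even x → Even y)

𝒫ᵒᵈₑ⇒chain : ∀ {m n xs} → IsPartition m n xs → 𝒫ᵒᵈₑ xs → AllPairs _≻_ xs
𝒫ᵒᵈₑ⇒chain π (xs! , ebo) =
  go (Linked⇒AllPairs (λ x≥y y≥z → ≤-trans y≥z x≥y) (IsPartition.nonincreasing π)) xs! ebo
  where
  go : ∀ {xs} → AllPairs _≥_ xs → Unique xs → EvensBelowOdds xs → AllPairs _≻_ xs
  go [] [] [] = []
  go (x≥ ∷ xs≥) (x≢ ∷ xs!) ((_ ∷ x<) ∷ ebo) =
    All.zipWith
      (λ ((x≥y , x≢y) , x<y) → let y<x = ≤∧≢⇒< x≥y (x≢y ∘ sym) in
        -- An odd `y` after an even `x` would give `x < y`, against `y<x`.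
        y<x , λ ex → decidable-stable (even? _) (λ oy → <-asym y<x (x<y ex oy)))
      (All.zip (x≥ , x≢) , x<)
    ∷ go xs≥ xs! (All.map All.tail ebo)

chain⇒𝒫ᵒᵈₑ : ∀ {xs} → AllPairs _≻_ xs → 𝒫ᵒᵈₑ xs
chain⇒𝒫ᵒᵈₑ ch = AllPairs.map (λ (x>y , _) → <⇒≢ x>y ∘ sym) ch , go ch
  where
  go : ∀ {xs} → AllPairs _≻_ xs → EvensBelowOdds xs
  go [] = []
  go (x≻ ∷ ch) =
    ((λ ex ox → contradiction ex ox) ∷
      All.map (λ (_ , e) ex oy → contradiction (e ex) oy) x≻)
    ∷ All.zipWith (λ ((y<x , _) , y<) → (λ _ _ → y<x) ∷ y<) (x≻ , go ch)

-- ys ⋖ xs: xs is obtained from ys by incrementing its last odd part.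
data _⋖_ : List ℕ → List ℕ → Set where
  here  : ∀ {x zs} → Odd x → All Even zs → (x ∷ zs) ⋖ (suc x ∷ zs)
  there : ∀ {x xs ys} → Odd x → ys ⋖ xs → (x ∷ ys) ⋖ (x ∷ xs)

-- Effect of moving one part.

private variable
  xs ys : List ℕ

⋖-length : ys ⋖ xs → length ys ≡ length xs
⋖-length (here _ _)  = refl
⋖-length (there _ r) = cong suc (⋖-length r)

⋖-sum : ys ⋖ xs → sum xs ≡ suc (sum ys)
⋖-sum (here _ _)       = refl
⋖-sum (there {x} _ r) = trans (cong (λ s → x + s) (⋖-sum r)) (+-suc x _)

⋖⇒¬allEven : ys ⋖ xs → ¬ All Even ys
⋖⇒¬allEven (here  ox _) (ex ∷ _) = ox ex
⋖⇒¬allEven (there ox _) (ex ∷ _) = ox ex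

⋖⇒¬allOdd : ys ⋖ xs → ¬ All Odd xs
⋖⇒¬allOdd (here ox _)  (osx ∷ _) = osx (odd⇒even-suc ox)
⋖⇒¬allOdd (there _ r)  (_ ∷ os)  = ⋖⇒¬allOdd r os

⋖-positive⁺ : ys ⋖ xs → All (1 ≤_) ys → All (1 ≤_) xs
⋖-positive⁺ (here _ _)  (_ ∷ ps) = s≤s z≤n ∷ ps
⋖-positive⁺ (there _ r) (p ∷ ps) = p ∷ ⋖-positive⁺ r ps

⋖-positive⁻ : ys ⋖ xs → All (1 ≤_) xs → All (1 ≤_) ys
-- The decremented part stays positive: it becomes odd, and 0 is even.
⋖-positive⁻ (here ox _)  (_ ∷ ps) = n≢0⇒n>0 (odd≢even ox (2 ∣0) ∘ sym) ∷ ps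
⋖-positive⁻ (there _ r) (p ∷ ps) = p ∷ ⋖-positive⁻ r ps

-- The parts before the moved one are odd, as it is before the increment. So `x > y` leaves room for
-- `suc y`, which is even and hence differs from `x`.
⋖-≻⁺ : ∀ {x} → Odd x → ys ⋖ xs → All (x ≻_) ys → All (x ≻_) xs
⋖-≻⁺ ox (here oy _) ((x>y , _) ∷ ps) =
  (≤∧≢⇒< x>y (odd≢even ox (odd⇒even-suc oy)) , λ ex → contradiction ex ox) ∷ ps
⋖-≻⁺ ox (there _ r) (p ∷ ps) = p ∷ ⋖-≻⁺ ox r ps

⋖-≻⁻ : ∀ {x} → Odd x → ys ⋖ xs → All (x ≻_) xs → All (x ≻_) ys
⋖-≻⁻ ox (here _ _) ((x>1+y , _) ∷ ps) = (<⇒≤ x>1+y , λ ex → contradiction ex ox) ∷ ps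
⋖-≻⁻ ox (there _ r) (p ∷ ps) = p ∷ ⋖-≻⁻ ox r ps

⋖-chain⁺ : ys ⋖ xs → AllPairs _≻_ ys → AllPairs _≻_ xs
⋖-chain⁺ (here _ ezs) (x≻ ∷ ch) =
  All.zipWith (λ ((x>z , _) , ez) → m≤n⇒m≤1+n x>z , λ _ → ez) (x≻ , ezs) ∷ ch
⋖-chain⁺ (there ox r) (x≻ ∷ ch) = ⋖-≻⁺ ox r x≻ ∷ ⋖-chain⁺ r ch

-- The parts after the moved one are the critical ones here: `suc x > z` gives only `z ≤ x`, and
-- equality is excluded because `x` is odd and `z` even.
⋖-chain⁻ : ys ⋖ xs → AllPairs _≻_ xs → AllPairs _≻_ ys
⋖-chain⁻ (here ox ezs) (x≻ ∷ ch) =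
  All.zipWith (λ { ((s≤s z≤x , _) , ez) → ≤∧≢⇒< z≤x (odd≢even ox ez) , λ _ → ez }) (x≻ , ezs) ∷ ch
⋖-chain⁻ (there ox r) (x≻ ∷ ch) = ⋖-≻⁻ ox r x≻ ∷ ⋖-chain⁻ r ch

chain⇒partition : ∀ {m n} → AllPairs _≻_ xs → All (1 ≤_) xs → length xs ≡ m → sum xs ≡ n →
  IsPartition m n xs
chain⇒partition ch = mkPartition (AllPairs⇒Linked (AllPairs.map (<⇒≤ ∘ proj₁) ch))

⋖-partition⁺ : ∀ {m n} → ys ⋖ xs → IsPartition m n ys → 𝒫ᵒᵈₑ ys →
  IsPartition m (suc n) xs × 𝒫ᵒᵈₑ xs
⋖-partition⁺ r π@(mkPartition _ pos len size) P =
  chain⇒partition ch (⋖-positive⁺ r pos) (trans (sym (⋖-length r)) len)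
    (trans (⋖-sum r) (cong suc size))
  , chain⇒𝒫ᵒᵈₑ ch
  where ch = ⋖-chain⁺ r (𝒫ᵒᵈₑ⇒chain π P)

⋖-partition⁻ : ∀ {m n} → ys ⋖ xs → IsPartition m (suc n) xs → 𝒫ᵒᵈₑ xs →
  IsPartition m n ys × 𝒫ᵒᵈₑ ys
⋖-partition⁻ r π@(mkPartition _ pos len size) P =
  chain⇒partition ch (⋖-positive⁻ r pos) (trans (⋖-length r) len)
    (suc-injective (trans (sym (⋖-sum r)) size))
  , chain⇒𝒫ᵒᵈₑ ch
  where ch = ⋖-chain⁻ r (𝒫ᵒᵈₑ⇒chain π P)

-- The two maps and their inverse laws.

lower : List ℕ → List ℕ
lower []       = []
lower (x ∷ xs) with even? x
... | yes _ = pred x ∷ xs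
... | no  _ = x ∷ lower xs

-- Testing only the tail singles out the last odd entry whenever there is one. On a nonempty
-- all-even list the head would be incremented, a case that `raise-⋖` excludes.
raise : List ℕ → List ℕ
raise []       = []
raise (x ∷ xs) with all? even? xs
... | yes _ = suc x ∷ xs
... | no  _ = x ∷ raise xs

lower-⋖ : AllPairs _≻_ xs → All (1 ≤_) xs → ¬ All Odd xs → lower xs ⋖ xs
lower-⋖ [] [] ¬odd = contradiction [] ¬odd
lower-⋖ {x ∷ _} (x≻ ∷ ch) (s≤s _ ∷ pos) ¬odd with even? x
-- By `_≻_` every part after the first even one is even, so the decremented part becomes the last
-- odd one.
... | yes ex = here (even-suc⇒odd ex) (All.map (λ (_ , e) → e ex) x≻)
... | no  ox = there ox (lower-⋖ ch pos (¬odd ∘ (ox ∷_)))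

raise-⋖ : AllPairs _≻_ ys → ¬ All Even ys → ys ⋖ raise ys
raise-⋖ [] ¬even = contradiction [] ¬even
raise-⋖ {y ∷ ys} (y≻ ∷ ch) ¬even with all? even? ys
... | yes eys = here (¬even ∘ (_∷ eys)) eys
-- An even `y` would force the whole tail to be even.
... | no ¬eys = there (λ ey → ¬eys (All.map (λ (_ , e) → e ey) y≻)) (raise-⋖ ch ¬eys)

-- Entries passed by `there` are odd and the entry `suc x` at `here` is even, so `lower` stops
-- exactly at the moved part. Together with `⋖⇒raise≡`, this reduces both inverse laws to `lower-⋖`
-- and `raise-⋖`.
⋖⇒lower≡ : ys ⋖ xs → lower xs ≡ ys
⋖⇒lower≡ (here {x} ox _) with even? (suc x)
... | yes _   = refl
... | no  osx = contradiction (odd⇒even-suc ox) osx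
⋖⇒lower≡ (there {x} ox r) with even? x
... | yes ex = contradiction ex ox
... | no  _  = cong (x ∷_) (⋖⇒lower≡ r)

⋖⇒raise≡ : ys ⋖ xs → raise ys ≡ xs
⋖⇒raise≡ (here {zs = zs} _ ezs) with all? even? zs
... | yes _    = refl
... | no  ¬ezs = contradiction ezs ¬ezs
⋖⇒raise≡ (there {x} {ys = ys} _ r) with all? even? ys
... | yes eys = contradiction eys (⋖⇒¬allEven r)
... | no  _   = cong (x ∷_) (⋖⇒raise≡ r)

-- Comparison of the counts.

notAllOdd? : Decidable (𝒫ᵒᵈₑ ∩ ∁ (All Odd))
notAllOdd? = 𝒫ᵒᵈₑ? ∩? ∁? (all? odd?)

notAllEven? : Decidable (𝒫ᵒᵈₑ ∩ ∁ (All Even))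
notAllEven? = 𝒫ᵒᵈₑ? ∩? ∁? (all? even?)

∈-filter-partitions⁻ : ∀ {P : List ℕ → Set} (P? : Decidable P) m n {λs} →
  λs ∈ filter P? (partitions m n) → IsPartition m n λs × P λs
∈-filter-partitions⁻ P? m n λs∈ with ∈-filter⁻ P? {xs = partitions m n} λs∈
... | λs∈′ , Pλs = Equivalence.to (∈-partitions m n _) λs∈′ , Pλs

∈-filter-partitions⁺ : ∀ {P : List ℕ → Set} (P? : Decidable P) m n {λs} →
  IsPartition m n λs → P λs → λs ∈ filter P? (partitions m n)
∈-filter-partitions⁺ P? m n π = ∈-filter⁺ P? (Equivalence.from (∈-partitions m n _) π)

count-notAllOdd-suc : ∀ m n → count notAllOdd? m (suc n) ≡ count notAllEven? m n
count-notAllOdd-suc m n = bijection⇒length≡ lower raise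
  (Unique.filter⁺ notAllOdd? (partitions-unique m (suc n)))
  (Unique.filter⁺ notAllEven? (partitions-unique m n))
  (λ x∈ → let
     π , P , ¬odd = ∈-filter-partitions⁻ notAllOdd? m (suc n) x∈
     r            = lower-⋖ (𝒫ᵒᵈₑ⇒chain π P) (IsPartition.positive π) ¬odd
     π′ , P′      = ⋖-partition⁻ r π P
   in ∈-filter-partitions⁺ notAllEven? m n π′ (P′ , ⋖⇒¬allEven r) , ⋖⇒raise≡ r)
  (λ y∈ → let
     π , P , ¬even = ∈-filter-partitions⁻ notAllEven? m n y∈
     r             = raise-⋖ (𝒫ᵒᵈₑ⇒chain π P) ¬even
     π′ , P′       = ⋖-partition⁺ r π P
   in ∈-filter-partitions⁺ notAllOdd? m (suc n) π′ (P′ , ⋖⇒¬allOdd r) , ⋖⇒lower≡ r)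

-- When all parts have the same parity, the comparison of even with odd parts is vacuous.
allOdd≐distinctOdd : (𝒫ᵒᵈₑ ∩ All Odd) ≐ DistinctOdd
allOdd≐distinctOdd =
  (λ ((xs! , _) , os) → xs! , os) ,
  (λ (xs! , os) →
    (xs! , All.map (λ ox → All.map (λ _ ex → contradiction ex ox) os) os) , os)

allEven≐distinctEven : (𝒫ᵒᵈₑ ∩ All Even) ≐ DistinctEven
allEven≐distinctEven =
  (λ ((xs! , _) , es) → xs! , es) ,
  (λ (xs! , es) →
    (xs! , All.map (λ _ → All.map (λ ey _ oy → contradiction ey oy) es) es) , es)

pᵒᵈₑ≡Dₒ+ : ∀ m n → pᵒᵈₑ m n ≡ Dₒ m n + count notAllOdd? m n
pᵒᵈₑ≡Dₒ+ m n = trans (length-filter-split 𝒫ᵒᵈₑ? (all? odd?) (partitions m n))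
  (cong (λ zs → length zs + count notAllOdd? m n)
    (filter-≐ (𝒫ᵒᵈₑ? ∩? all? odd?) distinctOdd? allOdd≐distinctOdd (partitions m n)))

pᵒᵈₑ≡Dₑ+ : ∀ m n → pᵒᵈₑ m n ≡ Dₑ m n + count notAllEven? m n
pᵒᵈₑ≡Dₑ+ m n = trans (length-filter-split 𝒫ᵒᵈₑ? (all? even?) (partitions m n))
  (cong (λ zs → length zs + count notAllEven? m n)
    (filter-≐ (𝒫ᵒᵈₑ? ∩? all? even?) distinctEven? allEven≐distinctEven (partitions m n)))

[m+k]-[n+k]≡m-n : ∀ m n k → + (m + k) - + (n + k) ≡ + m - + n
[m+k]-[n+k]≡m-n m n k = begin
  + (m + k) - + (n + k) ≡⟨ [+m]-[+n]≡m⊖n (m + k) (n + k) ⟩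
  (m + k) ⊖ (n + k)     ≡⟨ cong₂ _⊖_ (+-comm m k) (+-comm n k) ⟩
  (k + m) ⊖ (k + n)     ≡⟨ +-cancelˡ-⊖ k m n ⟩
  m ⊖ n                 ≡⟨ [+m]-[+n]≡m⊖n m n ⟨
  + m - + n             ∎
  where open ≡-Reasoning

mainTheorem1 : ∀ (m n : ℕ) → m ≥ 1 → n ≥ 1 →
    + pᵒᵈₑ m n - + pᵒᵈₑ m (n ∸ 1) ≡ + Dₒ m n - + Dₑ m (n ∸ 1)
mainTheorem1 m (suc n) _ _ = begin
  + pᵒᵈₑ m (suc n) - + pᵒᵈₑ m n
    -- The two sizes are split differently, by all odd at `suc n` and by all even at `n`, so that
    -- the bijection identifies the remainders and they cancel.
    ≡⟨ cong₂ (λ a b → + a - + b) (pᵒᵈₑ≡Dₒ+ m (suc n)) (pᵒᵈₑ≡Dₑ+ m n) ⟩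
  + (Dₒ m (suc n) + count notAllOdd? m (suc n)) - + (Dₑ m n + count notAllEven? m n)
    ≡⟨ cong (λ k → + (Dₒ m (suc n) + k) - + (Dₑ m n + count notAllEven? m n)) (count-notAllOdd-suc m n) ⟩
  + (Dₒ m (suc n) + count notAllEven? m n) - + (Dₑ m n + count notAllEven? m n)
    ≡⟨ [m+k]-[n+k]≡m-n (Dₒ m (suc n)) (Dₑ m n) (count notAllEven? m n) ⟩
  + Dₒ m (suc n) - + Dₑ m n ∎
  where open ≡-Reasoning
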